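{- Let $n\in\mathbb{N}$, $n\ge 1$, and let $f:\{0,1\}^n\to\{0,1\}^n$ be a Boolean network whose dynamics is Hamiltonian or quasi-Hamiltonian. Then the interaction graph $G(f)$ is unilaterally connected.
   Context: A Boolean network with $n$ variables is a map $f=(f_1,\dots,f_n):\{0,1\}^n\to\{0,1\}^n$; write $[n]=\{1,\dots,n\}$. Its dynamics is the digraph $\Gamma(f)$ with vertex set $\{0,1\}^n$ and arcs $(x,f(x))$, $x\in\{0,1\}^n$. A trajectory of $f$ is a path (directed walk $v_0,v_1,\dots,v_k$ along arcs) in $\Gamma(f)$ that does not repeat arcs. $f$ is Hamiltonian if $\Gamma(f)$ has a trajectory that visits all configurations of $\{0,1\}^n$ (hence $f$ has a unique attractor, which is a fixed point or a limit cycle, a limit cycle being a cycle of $\Gamma(f)$ of length at least two). $f$ is quasi-Hamiltonian if $\Gamma(f)$ consists of a cycle of length $2^n-1$ and a fixed point. $f_j$ depends on $x_i$ if there is $x\in\{0,1\}^n$ with $f_j(x)\ne f_j(x\oplus e_i)$, where $e_i$ is the $i$-th unit vector and $\oplus$ is componentwise addition modulo 2. The interaction graph $G(f)$ is the digraph on $[n]$ with an arc $(i,j)$ (loops allowed) exactly when $f_j$ depends on $x_i$. A digraph is unilaterally connected if for every pair of vertices $\{x,y\}$ there is a directed path from $x$ to $y$ or from $y$ to $x$. -}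

module Defs where

open import Data.Bool.Base using (Bool; true; false; _xor_)
open import Data.Fin.Base using (Fin)
open import Data.List.Base using (List; []; _∷_; _++_; [_]; length; zip)
open import Data.List.Membership.Propositional using (_∈_; _∉_)
open import Data.List.Relation.Unary.Linked using (Linked)
open import Data.List.Relation.Unary.Unique.Propositional using (Unique)
open import Data.Nat.Base using (ℕ; suc; _^_; _∸_)
open import Data.Product.Base using (∃-syntax; _×_)
open import Data.Sum.Base using (_⊎_)
open import Data.Vec.Base using (Vec; lookup; replicate; zipWith; _[_]≔_)
open import Level using (0ℓ)
open import Relation.Binary.Construct.Closure.ReflexiveTransitive using (Star)
open import Relation.Binary.Core using (Rel)
open import Relation.Binary.PropositionalEquality using (_≡_; _≢_)

-- A digraph is given by its vertex set and its arc relation; loops are allowed.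
Digraph : Set → Set₁
Digraph V = Rel V 0ℓ

module _ {V : Set} where

  -- The consecutive pairs of v₀ , v₁ , … , vₖ, where the list is v₁ , … , vₖ.
  arcs : V → List V → List (V × V)
  arcs v₀ vs = zip (v₀ ∷ vs) vs

  -- The list excludes the initial vertex v₀, so its length is the number of
  -- arcs; in particular a walk has at least one vertex.
  IsWalk : Digraph V → V → List V → Set
  IsWalk G v₀ vs = Linked G (v₀ ∷ vs)

  IsArcSimpleWalk : Digraph V → V → List V → Set
  IsArcSimpleWalk G v₀ vs = IsWalk G v₀ vs × Unique (arcs v₀ vs)

  -- A cycle v₀ → v₁ → … → vₖ → v₀ on k + 1 distinct vertices; its length is
  -- k + 1, a loop being a cycle of length one.
  IsCycle : Digraph V → V → List V → Set
  IsCycle G v₀ vs = IsWalk G v₀ (vs ++ [ v₀ ]) × Unique (v₀ ∷ vs)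

  UnilaterallyConnected : Digraph V → Set
  UnilaterallyConnected G = ∀ x y → Star G x y ⊎ Star G y x

Config : ℕ → Set
Config n = Vec Bool n

BooleanNetwork : ℕ → Set
BooleanNetwork n = Config n → Config n

infixl 6 _⊕_

_⊕_ : ∀ {n} → Config n → Config n → Config n
_⊕_ = zipWith _xor_

e : ∀ {n} → Fin n → Config n
e {n} i = replicate n false [ i ]≔ true

module _ {n : ℕ} (f : BooleanNetwork n) where

  Γ : Digraph (Config n)
  Γ x y = y ≡ f x

  IsTrajectory : Config n → List (Config n) → Set
  IsTrajectory = IsArcSimpleWalk Γ

  Hamiltonian : Set
  Hamiltonian = ∃[ v₀ ] ∃[ vs ] IsTrajectory v₀ vs × (∀ x → x ∈ v₀ ∷ vs)

  -- Every vertex of Γ has exactly one out-arc, and the cycle and the loop at p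
  -- contain an out-arc of each of their vertices.  So Γ consists of these two
  -- as soon as they cover all vertices.
  QuasiHamiltonian : Set
  QuasiHamiltonian =
    ∃[ v₀ ] ∃[ vs ] ∃[ p ]
      IsCycle Γ v₀ vs × suc (length vs) ≡ 2 ^ n ∸ 1 ×
      Γ p p × p ∉ v₀ ∷ vs ×
      (∀ x → x ∈ v₀ ∷ vs ⊎ x ≡ p)

  DependsOn : Fin n → Fin n → Set
  DependsOn j i = ∃[ x ] lookup (f x) j ≢ lookup (f (x ⊕ e i)) j

  InteractionGraph : Digraph (Fin n)
  InteractionGraph i j = DependsOn j i

-- Suppose no path joins i and j, and let A ∋ i and B ∋ j be their sets of
-- ancestors, so that j ∉ A and i ∉ B.  A is closed under in-neighbours, so f
-- induces a factor map on the configurations of A, and flipping the coordinate j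
-- does not change the A-projection of a configuration.
--
-- If f is Hamiltonian from v₀, the configuration v₀ ⊕ e j is f^s(v₀) for some
-- s > 0.  Hence the projected orbit returns to its start, and as it covers all
-- configurations of A, it is a cycle of length 2^|A|.  The same holds for B; say
-- |B| ≤ |A|.  Then 2^|A| divides s, so 2^|B| divides s, so v₀ and v₀ ⊕ e j have
-- the same B-projection, although j ∈ B.
--
-- If f is quasi-Hamiltonian with fixed point p, then p ⊕ e j is on the cycle
-- and has the A-projection of p, which is fixed by the factor map.  Hence all
-- configurations of the cycle have this projection, although p ⊕ e i does not.
module Submission where

open import Defs
open import Data.Nat.Base using (ℕ; _≤_)
open import Data.Sum.Base using (_⊎_)

open import Data.Bool.Base using (true; false; not; _xor_)
open import Data.Bool.Properties using (_≟_; xor-comm; xor-identityʳ; not-¬)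
open import Data.Fin.Base using (Fin; zero; suc; toℕ; fromℕ<)
open import Data.Fin.Permutation using (↔⇒≡)
open import Data.Fin.Properties
  using (any?; inj⇒≟; toℕ<n; toℕ-fromℕ<; toℕ-injective; 2↔Bool; *↔×)
open import Data.Fin.Subset using (Subset; inside; outside; _∈_; _∉_; _⊃_; _∪_; ⁅_⁆; ∣_∣)
open import Data.Fin.Subset.Induction using (Acc; acc; ⊃-wellFounded)
open import Data.Fin.Subset.Properties
  using (_∈?_; drop-there; x∈⁅x⁆; x∈⁅y⁆⇒x≡y; x∈p∪q⁻; x∈p∪q⁺; p⊆p∪q)
open import Data.List.Base using ([]; _∷_; _++_; [_])
import Data.List.Membership.Propositional as List
open import Data.List.Relation.Unary.Any using (here; there)
open import Data.List.Relation.Unary.Linked using ([-]; _∷_)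
open import Data.Nat.Base
  using (zero; suc; _+_; _*_; _∸_; _^_; _<_; _%_; _/_; NonZero; z<s; >-nonZero)
open import Data.Nat.Divisibility using (_∣_; divides; ∣-trans; m%n≡0⇒n∣m; m∣m*n)
open import Data.Nat.DivMod using (m≡m%n+[m/n]*n; m%n<n)
open import Data.Nat.GeneralisedArithmetic using (fold; fold-+)
open import Data.Nat.Induction using (<-rec)
import Data.Nat.Properties as ℕ
open import Data.Product.Base using (∃; ∃-syntax; _×_; _,_; proj₁; proj₂)
open import Data.Product.Function.NonDependent.Propositional using (_×-↔_)
open import Data.Sum.Base using (inj₁; inj₂; [_,_]′)
open import Data.Vec.Base using ([]; _∷_; here; there; lookup; replicate)
import Data.Vec.Base as Vec
open import Data.Vec.Properties
  using (lookup-zipWith; lookup-replicate; lookup∘update; lookup∘update′; zipWith-identityʳ)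
open import Function.Base using (_∘_; id)
open import Function.Bundles using (_↔_; Inverse; mk↔ₛ′; _⇔_; mk⇔; Equivalence)
open import Function.Properties.Inverse using (↔-sym; ↔-trans; ↔⇒↣)
open import Relation.Binary.Construct.Closure.ReflexiveTransitive using (Star; ε; _◅_; _◅◅_)
open import Relation.Binary.Core using (Rel)
open import Relation.Binary.Definitions using (Decidable; DecidableEquality; tri<; tri≈; tri>)
open import Relation.Binary.PropositionalEquality
  using (_≡_; _≢_; refl; sym; trans; cong; cong₂; subst; module ≡-Reasoning)
open import Relation.Nullary.Decidable
  using (Dec; yes; no; _×-dec_; ¬?; decidable-stable; map′)
open import Relation.Nullary.Negation using (¬_; contradiction)
open import Level using (0ℓ)

private
  variable
    n : ℕ

-- Counting configurations, and divisibility between their numbers.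

config↔Fin : ∀ n → Config n ↔ Fin (2 ^ n)
config↔Fin zero    = mk↔ₛ′ (λ _ → zero) (λ _ → []) (λ { zero → refl }) (λ { [] → refl })
config↔Fin (suc n) =
  ↔-trans (mk↔ₛ′ Vec.uncons (λ { (b , x) → b ∷ x }) (λ { (_ , _) → refl }) (λ { (_ ∷ _) → refl }))
  (↔-trans (↔-sym 2↔Bool ×-↔ config↔Fin n) (↔-sym *↔×))

2^-mono-∣ : ∀ {m n} → m ≤ n → 2 ^ m ∣ 2 ^ n
2^-mono-∣ {m} {n} m≤n = subst (2 ^ m ∣_)
  (trans (sym (ℕ.^-distribˡ-+-* 2 m (n ∸ m))) (cong (2 ^_) (ℕ.m+[n∸m]≡n m≤n)))
  (m∣m*n (2 ^ (n ∸ m)))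

-- Orbits of a self-map and their least periods.

module _ {A : Set} (g : A → A) (u : A) where

  private
    orbit : ℕ → A
    orbit = fold u g

    IsPeriod : ℕ → Set
    IsPeriod t = orbit t ≡ u

  orbit-+-period : ∀ m {t} → IsPeriod t → orbit (m + t) ≡ orbit m
  orbit-+-period m p = trans (fold-+ u g m) (cong (λ z → fold z g m) p)

  period-* : ∀ {a} → IsPeriod a → ∀ k → IsPeriod (k * a)
  period-* p zero        = refl
  period-* {a} p (suc k) = trans (orbit-+-period a (period-* p k)) p

  orbit-% : ∀ {a} .{{_ : NonZero a}} → IsPeriod a → ∀ t → orbit (t % a) ≡ orbit t
  orbit-% {a} p t = begin
    orbit (t % a)                ≡⟨ orbit-+-period (t % a) (period-* p (t / a)) ⟨
    orbit (t % a + (t / a) * a)  ≡⟨ cong orbit (m≡m%n+[m/n]*n t a) ⟨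
    orbit t                      ∎
    where open ≡-Reasoning

  -- Minimality admits `t` equal to zero and concludes `t ≡ 0`, so that it applies directly to
  -- remainders modulo `a`.
  IsLeastPeriod : ℕ → Set
  IsLeastPeriod a = 0 < a × IsPeriod a × (∀ {t} → t < a → IsPeriod t → t ≡ 0)

  leastPeriod : DecidableEquality A → ∀ s → 0 < s → IsPeriod s → ∃ IsLeastPeriod
  leastPeriod _≟A_ = <-rec _ descend
    where
    descend : ∀ s → (∀ {t} → t < s → 0 < t → IsPeriod t → ∃ IsLeastPeriod) →
              0 < s → IsPeriod s → ∃ IsLeastPeriod
    descend s rec 0<s p with ℕ.anyUpTo? (λ t → (0 ℕ.<? t) ×-dec (orbit t ≟A u)) s
    ... | yes (t , t<s , 0<t , q) = rec t<s 0<t q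
    ... | no ∄ = s , 0<s , p , least
      where
      least : ∀ {t} → t < s → IsPeriod t → t ≡ 0
      least {zero}  _   _ = refl
      least {suc t} t<s q = contradiction (suc t , t<s , z<s , q) ∄

  leastPeriod-∣ : ∀ {a} → IsLeastPeriod a → ∀ t → IsPeriod t → a ∣ t
  leastPeriod-∣ {a} (0<a , p , least) t q =
    m%n≡0⇒n∣m t a (least (m%n<n t a) (trans (orbit-% p t) q))
    where instance _ = >-nonZero 0<a

  -- Applying `g` another `a ∸ j` times to both sides of a coincidence would give the period
  -- `(a ∸ j) + i`, which is positive and below `a`.
  orbit-injective-< : ∀ {a i j} → IsLeastPeriod a → i < j → j < a → orbit i ≢ orbit j
  orbit-injective-< {a} {i} {j} (_ , p , least) i<j j<a eq =
    contradiction (least k<a q) (ℕ.m<n⇒n≢0 (ℕ.<-≤-trans (ℕ.m<n⇒0<n∸m j<a) (ℕ.m≤m+n _ i)))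
    where
    k<a : (a ∸ j) + i < a
    k<a = subst ((a ∸ j) + i <_) (ℕ.m∸n+n≡m (ℕ.<⇒≤ j<a)) (ℕ.+-monoʳ-< (a ∸ j) i<j)
    q : IsPeriod ((a ∸ j) + i)
    q = begin
      orbit ((a ∸ j) + i)         ≡⟨ fold-+ u g (a ∸ j) ⟩
      fold (orbit i) g (a ∸ j)    ≡⟨ cong (λ z → fold z g (a ∸ j)) eq ⟩
      fold (orbit j) g (a ∸ j)    ≡⟨ fold-+ u g (a ∸ j) ⟨
      orbit ((a ∸ j) + j)         ≡⟨ cong orbit (ℕ.m∸n+n≡m (ℕ.<⇒≤ j<a)) ⟩
      orbit a                     ≡⟨ p ⟩
      u                           ∎
      where open ≡-Reasoning

  orbit-injective : ∀ {a i j} → IsLeastPeriod a → i < a → j < a → orbit i ≡ orbit j → i ≡ j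
  orbit-injective {i = i} {j} l i<a j<a eq with ℕ.<-cmp i j
  ... | tri< i<j _ _ = contradiction eq (orbit-injective-< l i<j j<a)
  ... | tri≈ _ i≡j _ = i≡j
  ... | tri> _ _ j<i = contradiction (sym eq) (orbit-injective-< l j<i i<a)

  -- The time that `covers` supplies for `x` is arbitrary; reduced modulo `a` it still reaches `x`,
  -- and `orbit-injective` makes it the only such time below `a`.
  leastPeriod↔ : ∀ {a} → IsLeastPeriod a → (∀ x → ∃[ t ] x ≡ orbit t) → Fin a ↔ A
  leastPeriod↔ {a} l@(0<a , p , _) covers = mk↔ₛ′ to from to∘from from∘to
    where
    instance _ = >-nonZero 0<a
    to : Fin a → A
    to i = orbit (toℕ i)
    from : A → Fin a
    from x = fromℕ< (m%n<n (proj₁ (covers x)) a)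
    to∘from : ∀ x → to (from x) ≡ x
    to∘from x = begin
      to (from x)                     ≡⟨ cong orbit (toℕ-fromℕ< (m%n<n (proj₁ (covers x)) a)) ⟩
      orbit (proj₁ (covers x) % a)    ≡⟨ orbit-% p (proj₁ (covers x)) ⟩
      orbit (proj₁ (covers x))        ≡⟨ proj₂ (covers x) ⟨
      x                               ∎
      where open ≡-Reasoning
    from∘to : ∀ i → from (to i) ≡ i
    from∘to i = toℕ-injective
      (orbit-injective l (toℕ<n (from (to i))) (toℕ<n i) (to∘from (to i)))

-- A covering orbit that returns to its start is a single cycle through all of `A`, so its least
-- period equals `N` by counting.
cyclic-period : ∀ {A : Set} {N} → A ↔ Fin N → (g : A → A) (u : A) →
                (∀ x → ∃[ t ] x ≡ fold u g t) →
                ∀ {s} → 0 < s → fold u g s ≡ u →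
                ∀ t → fold u g t ≡ u ⇔ N ∣ t
cyclic-period A↔Fin g u covers {s} 0<s p t
  with a , l@(_ , q , _) ← leastPeriod g u (inj⇒≟ (↔⇒↣ A↔Fin)) s 0<s p
  rewrite sym (↔⇒≡ (↔-trans (leastPeriod↔ g u l covers) A↔Fin))
  = mk⇔ (leastPeriod-∣ g u l t) λ { (divides k refl) → period-* g u q k }

-- Flipping one coordinate and projecting to a set of coordinates.

flip : Fin n → Config n → Config n
flip j x = x ⊕ e j

lookup-flip : ∀ (j : Fin n) x → lookup (flip j x) j ≡ not (lookup x j)
lookup-flip {n} j x = begin
  lookup (flip j x) j             ≡⟨ lookup-zipWith _xor_ j x (e j) ⟩
  lookup x j xor lookup (e j) j   ≡⟨ cong (lookup x j xor_) (lookup∘update j (replicate n false) true) ⟩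
  lookup x j xor true             ≡⟨ xor-comm (lookup x j) true ⟩
  not (lookup x j)                ∎
  where open ≡-Reasoning

lookup-flip-≢ : ∀ (j : Fin n) x → lookup (flip j x) j ≢ lookup x j
lookup-flip-≢ j x eq = not-¬ refl (trans (sym eq) (lookup-flip j x))

lookup-flip-other : ∀ {j k : Fin n} → k ≢ j → ∀ x → lookup (flip j x) k ≡ lookup x k
lookup-flip-other {n} {j} {k} k≢j x = begin
  lookup (flip j x) k             ≡⟨ lookup-zipWith _xor_ k x (e j) ⟩
  lookup x k xor lookup (e j) k   ≡⟨ cong (lookup x k xor_) (lookup∘update′ k≢j (replicate n false) true) ⟩
  lookup x k xor lookup (replicate n false) k ≡⟨ cong (lookup x k xor_) (lookup-replicate k false) ⟩
  lookup x k xor false            ≡⟨ xor-identityʳ (lookup x k) ⟩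
  lookup x k                      ∎
  where open ≡-Reasoning

restrict : (A : Subset n) → Config n → Config ∣ A ∣
restrict []            []      = []
restrict (inside  ∷ A) (b ∷ x) = b ∷ restrict A x
restrict (outside ∷ A) (_ ∷ x) = restrict A x

extend : (A : Subset n) → Config ∣ A ∣ → Config n
extend []            []      = []
extend (inside  ∷ A) (b ∷ z) = b ∷ extend A z
-- Any default would do here: for an in-closed `A`, `restrict-f-cong` shows that the values outside
-- `A` do not influence `factor`.
extend (outside ∷ A) z       = false ∷ extend A z

restrict-extend : ∀ (A : Subset n) z → restrict A (extend A z) ≡ z
restrict-extend []            []      = refl
restrict-extend (inside  ∷ A) (b ∷ z) = cong (b ∷_) (restrict-extend A z)
restrict-extend (outside ∷ A) z       = restrict-extend A z

restrict-ext : ∀ (A : Subset n) {x y} → (∀ {k} → k ∈ A → lookup x k ≡ lookup y k) →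
               restrict A x ≡ restrict A y
restrict-ext []            {[]}    {[]}    eq = refl
restrict-ext (inside  ∷ A) {_ ∷ _} {_ ∷ _} eq = cong₂ _∷_ (eq here) (restrict-ext A (eq ∘ there))
restrict-ext (outside ∷ A) {_ ∷ _} {_ ∷ _} eq = restrict-ext A (eq ∘ there)

restrict-lookup : ∀ (A : Subset n) {x y} → restrict A x ≡ restrict A y →
                  ∀ {k} → k ∈ A → lookup x k ≡ lookup y k
restrict-lookup (inside  ∷ A) {_ ∷ _} {_ ∷ _} eq here        = cong Vec.head eq
restrict-lookup (inside  ∷ A) {_ ∷ _} {_ ∷ _} eq (there k∈A) = restrict-lookup A (cong Vec.tail eq) k∈A
restrict-lookup (outside ∷ A) {_ ∷ _} {_ ∷ _} eq (there k∈A) = restrict-lookup A eq k∈A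

restrict-flip-∉ : ∀ (A : Subset n) {j} → j ∉ A → ∀ x → restrict A (flip j x) ≡ restrict A x
restrict-flip-∉ A j∉A x = restrict-ext A λ k∈A →
  lookup-flip-other (λ { refl → j∉A k∈A }) x

restrict-flip-∈ : ∀ (A : Subset n) {j} → j ∈ A → ∀ x → restrict A (flip j x) ≢ restrict A x
restrict-flip-∈ A {j} j∈A x eq = lookup-flip-≢ j x (restrict-lookup A eq j∈A)

flip-≢ : ∀ (j : Fin n) x → flip j x ≢ x
flip-≢ j x eq = lookup-flip-≢ j x (cong (λ y → lookup y j) eq)

flip-suc : ∀ (k : Fin n) b x → flip (suc k) (b ∷ x) ≡ b ∷ flip k x
flip-suc k b x = cong (_∷ flip k x) (xor-identityʳ b)

-- Two configurations with the same `A`-projection are joined by flips outside `A`. The induction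
-- fixes one head at a time and absorbs it into `g`.
depends-only-on : ∀ {B : Set} (A : Subset n) (g : Config n → B) →
                  (∀ {k} → k ∉ A → ∀ x → g x ≡ g (flip k x)) →
                  ∀ {x y} → restrict A x ≡ restrict A y → g x ≡ g y
depends-only-on []            g inv {[]}    {[]}    eq = refl
depends-only-on (inside  ∷ A) g inv {b ∷ x} {c ∷ y} eq with refl ← cong Vec.head eq =
  depends-only-on A (g ∘ (b ∷_))
    (λ {k} k∉A z → trans (inv (k∉A ∘ drop-there) (b ∷ z)) (cong g (flip-suc k b z)))
    (cong Vec.tail eq)
depends-only-on (outside ∷ A) g inv {b ∷ x} {c ∷ y} eq =
  trans (head-irrelevant b c x)
    (depends-only-on A (g ∘ (c ∷_))
      (λ {k} k∉A z → trans (inv (k∉A ∘ drop-there) (c ∷ z)) (cong g (flip-suc k c z)))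
      eq)
  where
  flip-head : ∀ b x → g (b ∷ x) ≡ g (not b ∷ x)
  flip-head b x = trans (inv {zero} (λ ()) (b ∷ x))
    (cong g (cong₂ _∷_ (xor-comm b true) (zipWith-identityʳ xor-identityʳ x)))
  head-irrelevant : ∀ b c x → g (b ∷ x) ≡ g (c ∷ x)
  head-irrelevant true  true  x = refl
  head-irrelevant true  false x = flip-head true x
  head-irrelevant false true  x = flip-head false x
  head-irrelevant false false x = refl

-- Ancestor sets in a finite digraph.

InClosed : Rel (Fin n) 0ℓ → Subset n → Set
InClosed R A = ∀ {k j} → R k j → j ∈ A → k ∈ A

module _ (R : Rel (Fin n) 0ℓ) (R? : Decidable R) (i : Fin n) where

  private
    AreAncestors : Subset n → Set
    AreAncestors A = ∀ {k} → k ∈ A → Star R k i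

  -- Starting from the singleton of `i`, a missing in-neighbour is added as long as there is one.
  -- This ends because subsets of a finite set cannot grow forever.
  ancestors : ∃[ A ] i ∈ A × InClosed R A × (∀ {k} → k ∈ A → Star R k i)
  ancestors = grow ⁅ i ⁆ (⊃-wellFounded _) (x∈⁅x⁆ i)
    (λ k∈ → subst (λ k → Star R k i) (sym (x∈⁅y⁆⇒x≡y _ k∈)) ε)
    where
    grow : ∀ A → Acc _⊃_ A → i ∈ A → AreAncestors A →
           ∃[ A ] i ∈ A × InClosed R A × AreAncestors A
    grow A (acc rec) i∈A anc
      with any? (λ k → any? λ j → R? k j ×-dec j ∈? A ×-dec ¬? (k ∈? A))
    ... | no ∄ = A , i∈A
               , (λ {k} {j} kRj j∈A → decidable-stable (k ∈? A) λ k∉A → ∄ (k , j , kRj , j∈A , k∉A))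
               , anc
    ... | yes (k , j , kRj , j∈A , k∉A) =
      grow (A ∪ ⁅ k ⁆)
        (rec (p⊆p∪q ⁅ k ⁆ , k , x∈p∪q⁺ (inj₂ (x∈⁅x⁆ k)) , k∉A))
        (p⊆p∪q ⁅ k ⁆ i∈A)
        λ l∈ → [ anc , (λ l∈⁅k⁆ → subst (λ l → Star R l i) (sym (x∈⁅y⁆⇒x≡y k l∈⁅k⁆)) (kRj ◅ anc j∈A)) ]′
                 (x∈p∪q⁻ A ⁅ k ⁆ l∈)

-- Search over configurations, and paths from walks.

anyConfig? : ∀ {P : Config n → Set} → (∀ x → Dec (P x)) → Dec (∃ P)
anyConfig? {n} {P} P? = map′
  (λ { (i , p) → from i , p })
  (λ { (x , p) → to x , subst P (sym (strictlyInverseʳ x)) p })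
  (any? (P? ∘ from))
  where open Inverse (config↔Fin n)

walk⇒reach : ∀ {V : Set} {G : Digraph V} {v} vs {x} → IsWalk G v vs → x List.∈ v ∷ vs → Star G v x
walk⇒reach _        _         (here refl) = ε
walk⇒reach (_ ∷ vs) (a ∷ w) (there x∈)  = a ◅ walk⇒reach vs w x∈

walk⇒reach-last : ∀ {V : Set} {G : Digraph V} {v w} vs {x} →
                  IsWalk G v (vs ++ [ w ]) → x List.∈ v ∷ vs → Star G x w
walk⇒reach-last []       (a ∷ _) (here refl) = a ◅ ε
walk⇒reach-last (_ ∷ vs) (a ∷ w) (here refl) = a ◅ walk⇒reach-last vs w (here refl)
walk⇒reach-last (_ ∷ vs) (a ∷ w) (there x∈)  = walk⇒reach-last vs w x∈

walk-init : ∀ {V : Set} {G : Digraph V} {v} vs {ws} → IsWalk G v (vs ++ ws) → IsWalk G v vs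
walk-init []       _       = [-]
walk-init (_ ∷ vs) (a ∷ w) = a ∷ walk-init vs w

-- The factor map on an in-closed set, and the two contradictions.

module _ (f : BooleanNetwork n) where

  dependsOn? : Decidable (InteractionGraph f)
  dependsOn? i j = anyConfig? λ x → ¬? (lookup (f x) j ≟ lookup (f (flip i x)) j)

  reach⇒fold : ∀ {x y} → Star (Γ f) x y → ∃[ t ] y ≡ fold x f t
  reach⇒fold ε = 0 , refl
  reach⇒fold {x} (refl ◅ r) with t , eq ← reach⇒fold r =
    -- The path applies `f` first at `x`, whereas `fold` adds its new `f` on the outside; `fold-+`
    -- moves the one to the other.
    suc t , trans eq (trans (sym (fold-+ x f t)) (cong (fold x f) (ℕ.+-comm t 1)))

  module _ (A : Subset n) (closed : InClosed (InteractionGraph f) A) where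

    -- If a flip outside `A` changed a component in `A`, that would be an arc into `A` from outside,
    -- against closure.
    restrict-f-cong : ∀ {x y} → restrict A x ≡ restrict A y → restrict A (f x) ≡ restrict A (f y)
    restrict-f-cong eq = restrict-ext A λ {j} j∈A →
      depends-only-on A (λ x → lookup (f x) j)
        (λ k∉A x → decidable-stable (_ ≟ _) λ dep → k∉A (closed (x , dep) j∈A))
        eq

    factor : BooleanNetwork ∣ A ∣
    factor = restrict A ∘ f ∘ extend A

    restrict-f : ∀ x → restrict A (f x) ≡ factor (restrict A x)
    restrict-f x = restrict-f-cong (sym (restrict-extend A (restrict A x)))

    restrict-fold : ∀ x t → restrict A (fold x f t) ≡ fold (restrict A x) factor t
    restrict-fold x zero    = refl
    restrict-fold x (suc t) = trans (restrict-f (fold x f t)) (cong factor (restrict-fold x t))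

    -- As `p` is fixed, the fibre of `restrict A` through `p` is mapped into itself by `f`.
    restrict-reach : ∀ {p x y} → f p ≡ p → restrict A x ≡ restrict A p →
                     Star (Γ f) x y → restrict A y ≡ restrict A p
    restrict-reach fix eq ε          = eq
    restrict-reach fix eq (refl ◅ r) =
      restrict-reach fix (trans (restrict-f-cong eq) (cong (restrict A) fix)) r

    -- The orbit passes through flip j v₀, where its A-projection returns to the start.
    restricted-orbit-period : ∀ {v₀} → (∀ x → Star (Γ f) v₀ x) → ∀ {j} → j ∉ A →
                              ∀ t → restrict A (fold v₀ f t) ≡ restrict A v₀ ⇔ 2 ^ ∣ A ∣ ∣ t
    restricted-orbit-period {v₀} covers {j} j∉A t with reach⇒fold (covers (flip j v₀))
    ... | zero  , eq = contradiction eq (flip-≢ j v₀)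
    ... | suc s , eq
      rewrite restrict-fold v₀ t =
      cyclic-period (config↔Fin ∣ A ∣) factor (restrict A v₀) covers-A {suc s} z<s returns t
      where
      covers-A : ∀ z → ∃[ t ] z ≡ fold (restrict A v₀) factor t
      covers-A z with t , eq ← reach⇒fold (covers (extend A z)) =
        t , trans (sym (restrict-extend A z)) (trans (cong (restrict A) eq) (restrict-fold v₀ t))
      returns : fold (restrict A v₀) factor (suc s) ≡ restrict A v₀
      returns = trans (sym (restrict-fold v₀ (suc s)))
        (trans (cong (restrict A) (sym eq)) (restrict-flip-∉ A j∉A v₀))

  -- The flip of `j` is invisible in `A` and visible in `B`. The coordinate `i` only serves to make
  -- the `B`-projected orbit return to its start.
  hamiltonian⇒⊥ : ∀ {v₀} → (∀ x → Star (Γ f) v₀ x) →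
    ∀ {A B} → InClosed (InteractionGraph f) A → InClosed (InteractionGraph f) B →
    ∣ B ∣ ≤ ∣ A ∣ → ∀ {i j} → i ∉ B → j ∉ A → ¬ j ∈ B
  hamiltonian⇒⊥ {v₀} covers {A} {B} A-closed B-closed B≤A i∉B j∉A j∈B
    with s , eq ← reach⇒fold (covers (flip _ v₀)) =
    restrict-flip-∈ B j∈B v₀ (trans (cong (restrict B) eq)
      (from (restricted-orbit-period B B-closed covers i∉B s) (∣-trans (2^-mono-∣ B≤A)
        (to (restricted-orbit-period A A-closed covers j∉A s)
          (trans (cong (restrict A) (sym eq)) (restrict-flip-∉ A j∉A v₀))))))
    where open Equivalence

  quasiHamiltonian⇒⊥ : QuasiHamiltonian f →
    ∀ {A} → InClosed (InteractionGraph f) A → ∀ {i j} → j ∉ A → ¬ i ∈ A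
  quasiHamiltonian⇒⊥ (v₀ , vs , p , (walk , _) , _ , p≡fp , _ , covers) {A} closed {i} {j} j∉A i∈A =
    restrict-flip-∈ A i∈A p
      (restrict-reach A closed (sym p≡fp) (restrict-flip-∉ A j∉A p)
        -- Passing through `v₀` joins the two flips without comparing their positions on the cycle.
        (walk⇒reach-last vs walk (on-cycle j)
          ◅◅ walk⇒reach vs (walk-init vs walk) (on-cycle i)))
    where
    on-cycle : ∀ k → flip k p List.∈ v₀ ∷ vs
    on-cycle k = [ id , (λ eq → contradiction eq (flip-≢ k p)) ]′ (covers (flip k p))

theorem3p3 : (n : ℕ) → 1 ≤ n → (f : BooleanNetwork n) →
    Hamiltonian f ⊎ QuasiHamiltonian f →
    UnilaterallyConnected (InteractionGraph f)
theorem3p3 n _ f ham i j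
  with A , i∈A , A-closed , A⇒i ← ancestors (InteractionGraph f) (dependsOn? f) i
     | B , j∈B , B-closed , B⇒j ← ancestors (InteractionGraph f) (dependsOn? f) j
  with j ∈? A | i ∈? B | ham
... | yes j∈A | _       | _ = inj₂ (A⇒i j∈A)
... | no _    | yes i∈B | _ = inj₁ (B⇒j i∈B)
... | no j∉A  | no _    | inj₂ quasi =
  contradiction i∈A (quasiHamiltonian⇒⊥ f quasi A-closed j∉A)
... | no j∉A  | no i∉B  | inj₁ (v₀ , vs , (walk , _) , covers) with ℕ.≤-total ∣ B ∣ ∣ A ∣
...   | inj₁ B≤A = contradiction j∈B
  (hamiltonian⇒⊥ f (walk⇒reach vs walk ∘ covers) A-closed B-closed B≤A i∉B j∉A)
-- The situation is symmetric under exchanging `i`, `A` with `j`, `B`.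
...   | inj₂ A≤B = contradiction i∈A
  (hamiltonian⇒⊥ f (walk⇒reach vs walk ∘ covers) B-closed A-closed A≤B j∉A i∉B)
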